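{- For every prime $p \equiv 11 \pmod{12}$ there is a symmetric subset $A \subset \mathbb{F}_p^2$ (i.e. $0 \notin A$ and $A = -A$) such that the Cayley graph $G = \operatorname{Cay}(\mathbb{F}_p^2, A)$ belongs to $\mathcal{W}_7$; that is, $G$ has diameter $2$, contains no triangle and no subgraph isomorphic to $K_{2,7}$, and is not a star.
   Context: All graphs are finite and simple. For an integer $t \ge 1$, $\mathcal{W}_t$ denotes the class of graphs other than stars (graphs $K_{1,m}$) that have diameter $2$ and contain neither a triangle $C_3$ nor a $K_{2,t}$ as a subgraph. For the additive group $\mathbb{F}_p^2$ and a symmetric set $A$, the Cayley graph $\operatorname{Cay}(\mathbb{F}_p^2, A)$ has vertex set $\mathbb{F}_p^2$, with $u, v$ adjacent iff $u - v \in A$. -}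

module Defs where

open import Data.Nat using (ℕ; _+_; _∸_; NonZero)
open import Data.Nat.DivMod using (_mod_)
open import Data.Fin using (Fin; toℕ)
open import Data.Product using (_×_; _,_; Σ; ∃; proj₁; proj₂)
open import Data.Sum using (_⊎_)
open import Data.Bool using (Bool; T)
open import Data.Empty using (⊥)
open import Relation.Nullary using (¬_)
open import Relation.Binary.PropositionalEquality using (_≡_; _≢_)
open import Function.Definitions using (Injective)

-- The prime field F_p, realised as Fin p with arithmetic mod p.
𝔽 : ℕ → Set
𝔽 p = Fin p

module _ (p : ℕ) .{{_ : NonZero p}} where

  0𝔽 : 𝔽 p
  0𝔽 = 0 mod p

  -- subtraction in F_p
  sub𝔽 : 𝔽 p → 𝔽 p → 𝔽 p
  sub𝔽 a b = (toℕ a + (p ∸ toℕ b)) mod p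

  -- the additive group F_p^2
  V : Set
  V = 𝔽 p × 𝔽 p

  0V : V
  0V = (0𝔽 , 0𝔽)

  _−V_ : V → V → V
  (a₁ , a₂) −V (b₁ , b₂) = (sub𝔽 a₁ b₁ , sub𝔽 a₂ b₂)

  negV : V → V
  negV x = 0V −V x

  -- A ⊆ F_p^2 given by its (Boolean) indicator function
  Symmetric : (V → Bool) → Set
  Symmetric A = (¬ T (A 0V)) × (∀ x → T (A x) → T (A (negV x)))

  -- adjacency in Cay(F_p^2, A): u ~ v iff u - v ∈ A
  CayAdj : (V → Bool) → V → V → Set
  CayAdj A u v = T (A (u −V v))

-- Generic notions for a graph given by an adjacency relation on a vertex type.
module _ {W : Set} (E : W → W → Set) where

  -- diameter exactly 2: any two distinct vertices are adjacent or have a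
  -- common neighbour, and some two distinct vertices are non-adjacent.
  HasDiameter2 : Set
  HasDiameter2 =
    (∀ u v → u ≢ v → E u v ⊎ Σ W (λ w → E u w × E w v))
    × Σ W (λ u → Σ W (λ v → u ≢ v × ¬ E u v))

  TriangleFree : Set
  TriangleFree = ∀ u v w → E u v → E v w → E w u → ⊥

  -- contains K_{2,t} as a (not necessarily induced) subgraph
  ContainsK2 : ℕ → Set
  ContainsK2 t = Σ W λ u → Σ W λ v → Σ (Fin t → W) λ f →
    u ≢ v × Injective _≡_ _≡_ f ×
    (∀ i → f i ≢ u × f i ≢ v × E u (f i) × E v (f i))

  -- G is a star K_{1,m}: some centre is adjacent to every other vertex
  -- and every edge contains the centre.
  IsStar : Set
  IsStar = Σ W λ c → (∀ v → v ≢ c → E c v) × (∀ u v → E u v → u ≡ c ⊎ v ≡ c)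

  -- membership in the class 𝒲_t
  InW : ℕ → Set
  InW t = (¬ IsStar) × HasDiameter2 × TriangleFree × (¬ ContainsK2 t)

-- A is the union of the punctured parabolas y = x² and y = -x².  As p ≡ 2 (mod 3), -3 is not a
-- square mod p, and this makes A sum-free, so the Cayley graph has no triangle.  As p ≡ 3 (mod 4),
-- d or -d is a square for every d ≠ 0, so every (s, t) ∉ A ∪ {0} is a sum of two points of A:
-- one on each parabola when s ≠ 0, and (x, ±x²) + (-x, ±x²) on a single parabola when s = 0.
-- A common neighbour w of u ≠ v gives such a decomposition u - v = (u - w) + (w - v).  Once the
-- two parabolas are fixed, the first summand is determined up to swapping the summands (two
-- points on the same parabola) or uniquely (different parabolas), so u and v have at most
-- 2 + 2 + 1 + 1 = 6 common neighbours.  The facts about squares and cubes mod p come from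
-- Fermat's little theorem.

module Submission where

open import Defs
open import Data.Nat using (ℕ; NonZero; _%_)
open import Data.Nat.Primality using (Prime)
open import Data.Bool using (Bool)
open import Data.Product using (Σ; _×_; _,_)
open import Relation.Binary.PropositionalEquality using (_≡_)

module Fermat where

  open import Data.Nat
  open import Data.Nat.Properties
  open import Data.Nat.Divisibility
  open import Data.Nat.DivMod using (m/n*n≡m)
  open import Data.Nat.Primality using (euclidsLemma; prime⇒nonTrivial)
  open import Data.Nat.Combinatorics using (_C_; nCk≡n!/k![n-k]!; k![n∸k]!∣n!; nCn≡1)
  open import Data.Nat.Tactic.RingSolver using (solve-∀)
  open import Data.Fin using (Fin; zero; suc; toℕ; fromℕ; inject₁)
  open import Data.Fin.Properties using (toℕ-fromℕ; toℕ-inject₁; toℕ<n)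
  open import Function using (_∘_)
  open import Data.Product using (∃; _,_; proj₁; proj₂)
  open import Data.Sum using (inj₁; inj₂)
  open import Relation.Nullary using (¬_; contradiction)
  open import Relation.Binary.PropositionalEquality
  import Algebra.Properties.CommutativeSemiring.Binomial +-*-commutativeSemiring as Binomial
  import Algebra.Properties.Semiring.Exp +-*-semiring as Exp
  import Algebra.Properties.Semiring.Mult +-*-semiring as Mult
  open import Algebra.Properties.Monoid.Sum +-0-monoid using (sum; sum-init-last; sum-cong-≗)

  n∣n! : ∀ {n} → 0 < n → n ∣ n !
  n∣n! {suc n} _ = m∣m*n (n !)

  ^-Exp : ∀ a n → a Exp.^ n ≡ a ^ n
  ^-Exp a zero    = refl
  ^-Exp a (suc n) = cong (a *_) (^-Exp a n)

  ×-Mult : ∀ n a → n Mult.× a ≡ n * a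
  ×-Mult zero    a = refl
  ×-Mult (suc n) a = cong (a +_) (×-Mult n a)

  ∣-sum : ∀ {d n} (f : Fin n → ℕ) → (∀ i → d ∣ f i) → d ∣ sum f
  ∣-sum {n = zero}  f d∣f = _ ∣0
  ∣-sum {n = suc n} f d∣f = ∣m∣n⇒∣m+n (d∣f zero) (∣-sum (f ∘ suc) (d∣f ∘ suc))

  middle-terms : ∀ q → ℕ → Fin q → ℕ
  middle-terms q a i = (suc q C suc (toℕ i)) * a ^ suc (toℕ i)

  binomial-theorem-1+ : ∀ q a → (1 + a) ^ suc q ≡ 1 + sum (middle-terms q a) + a ^ suc q
  binomial-theorem-1+ q a = begin
    (1 + a) ^ suc q                                       ≡⟨ cong (_^ suc q) (+-comm 1 a) ⟩
    (a + 1) ^ suc q                                       ≡⟨ ^-Exp (a + 1) (suc q) ⟨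
    (a + 1) Exp.^ suc q                                   ≡⟨ Binomial.theorem (suc q) a 1 ⟩
    T zero + sum (T ∘ suc)                                ≡⟨ cong (T zero +_) (sum-init-last (T ∘ suc)) ⟩
    T zero + (sum (T ∘ suc ∘ inject₁) + T (suc (fromℕ q)))
      ≡⟨ cong₂ _+_ T-first (cong₂ _+_ (sum-cong-≗ T-middle) T-last) ⟩
    1 + (sum (middle-terms q a) + a ^ suc q)              ≡⟨ +-assoc 1 _ (a ^ suc q) ⟨
    1 + sum (middle-terms q a) + a ^ suc q               ∎
    where
    open ≡-Reasoning
    n = suc q
    T = Binomial.binomialTerm a 1 n
    T≡ : ∀ k → T k ≡ (n C toℕ k) * a ^ toℕ k
    T≡ k = begin
      (n C toℕ k) Mult.× (a Exp.^ toℕ k * 1 Exp.^ (n ∸ toℕ k)) ≡⟨ ×-Mult (n C toℕ k) _ ⟩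
      (n C toℕ k) * (a Exp.^ toℕ k * 1 Exp.^ (n ∸ toℕ k))
        ≡⟨ cong₂ (λ x y → (n C toℕ k) * (x * y))
                 (^-Exp a (toℕ k)) (trans (^-Exp 1 (n ∸ toℕ k)) (^-zeroˡ (n ∸ toℕ k))) ⟩
      (n C toℕ k) * (a ^ toℕ k * 1) ≡⟨ cong ((n C toℕ k) *_) (*-identityʳ (a ^ toℕ k)) ⟩
      (n C toℕ k) * a ^ toℕ k ∎
    T-first : T zero ≡ 1
    T-first = T≡ zero
    T-middle : ∀ i → T (suc (inject₁ i)) ≡ middle-terms q a i
    T-middle i = trans (T≡ (suc (inject₁ i))) (cong (λ j → (n C suc j) * a ^ suc j) (toℕ-inject₁ i))
    T-last : T (suc (fromℕ q)) ≡ a ^ n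
    T-last = begin
      T (suc (fromℕ q))           ≡⟨ T≡ (suc (fromℕ q)) ⟩
      (n C n') * a ^ n'           ≡⟨ cong (λ j → (n C suc j) * a ^ suc j) (toℕ-fromℕ q) ⟩
      (n C n) * a ^ n             ≡⟨ cong (_* a ^ n) (nCn≡1 n) ⟩
      1 * a ^ n                   ≡⟨ *-identityˡ (a ^ n) ⟩
      a ^ n                       ∎
      where n' = suc (toℕ (fromℕ q))

  module _ {p : ℕ} (p-prime : Prime p) where

    prime>1 : 1 < p
    prime>1 = nonTrivial⇒n>1 p {{prime⇒nonTrivial p-prime}}

    prime∤factorial : ∀ {k} → k < p → ¬ p ∣ k !
    prime∤factorial {zero}  _   p∣1 = <⇒≢ prime>1 (sym (∣1⇒≡1 p∣1))
    prime∤factorial {suc k} k<p p∣k! with euclidsLemma (suc k) (k !) p-prime p∣k!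
    ... | inj₁ p∣1+k = <⇒≱ k<p (∣⇒≤ p∣1+k)
    ... | inj₂ p∣k!  = prime∤factorial (<-trans (n<1+n k) k<p) p∣k!

    prime∣binomial : ∀ {k} → 0 < k → k < p → p ∣ p C k
    prime∣binomial {k} 0<k k<p
      with euclidsLemma (p C k) (k ! * (p ∸ k) !) p-prime p∣C*k!*[p∸k]!
      where
      instance _ = k !* (p ∸ k) !≢0
      p∣C*k!*[p∸k]! : p ∣ (p C k) * (k ! * (p ∸ k) !)
      p∣C*k!*[p∸k]! = subst (p ∣_)
        (sym (trans (cong (_* (k ! * (p ∸ k) !)) (nCk≡n!/k![n-k]! (<⇒≤ k<p)))
                    (m/n*n≡m (k![n∸k]!∣n! (<⇒≤ k<p)))))
        (n∣n! (<-trans 0<k k<p))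
    ... | inj₁ p∣C = p∣C
    ... | inj₂ p∣k!*[p∸k]! with euclidsLemma (k !) ((p ∸ k) !) p-prime p∣k!*[p∸k]!
    ...   | inj₁ p∣k!     = contradiction p∣k! (prime∤factorial k<p)
    ...   | inj₂ p∣[p∸k]! = contradiction p∣[p∸k]! (prime∤factorial (∸-monoʳ-< 0<k (<⇒≤ k<p)))

  fermat : ∀ {p} → Prime p → ∀ a → ∃ λ k → a ^ p ≡ a + k * p
  fermat {zero}  p-prime = contradiction (prime>1 p-prime) λ ()
  fermat {suc q} p-prime zero    = 0 , refl
  fermat {suc q} p-prime (suc a) = m + k , (begin
    (1 + a) ^ suc q                             ≡⟨ binomial-theorem-1+ q a ⟩
    1 + sum (middle-terms q a) + a ^ suc q      ≡⟨ cong₂ (λ x y → 1 + x + y) middle≡mp a^p≡a+kp ⟩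
    1 + m * suc q + (a + k * suc q)             ≡⟨ regroup m k a (suc q) ⟩
    1 + a + (m + k) * suc q                     ∎)
    where
    open ≡-Reasoning
    p∣middle : ∀ i → suc q ∣ middle-terms q a i
    p∣middle i = ∣m⇒∣m*n _ (prime∣binomial p-prime (s≤s z≤n) (s≤s (toℕ<n i)))
    k = proj₁ (fermat p-prime a)
    a^p≡a+kp = proj₂ (fermat p-prime a)
    m = _∣_.quotient (∣-sum _ p∣middle)
    middle≡mp = _∣_.equality (∣-sum _ p∣middle)
    regroup : ∀ m k a p → 1 + m * p + (a + k * p) ≡ 1 + a + (m + k) * p
    regroup = solve-∀

module Congruence {p : ℕ} (p-prime : Prime p) where

  open import Data.Nat as ℕ using (zero; suc; z≤n; s≤s)
  import Data.Nat.Properties as ℕ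
  import Data.Nat.Divisibility as ℕ
  import Data.Nat.Tactic.RingSolver as ℕS
  open import Data.Nat.Primality using (euclidsLemma; prime⇒nonZero)
  open import Data.Integer hiding (_%_; ∣_∣; suc; pred; NonZero)
  import Data.Integer.Base as ℤ
  open import Data.Integer.Properties
  open import Data.Integer.Divisibility.Signed
  open import Data.Integer.DivMod using (n%d<d; a≡a%n+[a/n]*n)
  open import Data.Integer.Tactic.RingSolver using (solve-∀)
  open import Data.Product using (∃; _,_)
  open import Data.Sum as Sum using (_⊎_; inj₁; inj₂; [_,_])
  open import Relation.Nullary using (¬_; Dec; contradiction)
  open import Relation.Nullary.Decidable using (map′)
  open import Relation.Binary.Bundles using (Setoid)
  open import Relation.Binary.PropositionalEquality hiding ([_])
  import Relation.Binary.Reasoning.Setoid as SetoidReasoning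

  open Fermat using (prime>1) renaming (fermat to fermatℕ)

  pos-^ : ∀ a n → + (a ℕ.^ n) ≡ (+ a) ^ n
  pos-^ a zero    = refl
  pos-^ a (suc n) = trans (pos-* a (a ℕ.^ n)) (cong (+ a *_) (pos-^ a n))

  P : ℤ
  P = + p

  instance
    p≢0 : ℕ.NonZero p
    p≢0 = prime⇒nonZero p-prime

  infix 4 _≈_
  record _≈_ (x y : ℤ) : Set where
    constructor mk≈
    field p∣x-y : P ∣ x - y
  open _≈_ public

  p∣0 : P ∣ 0ℤ
  p∣0 = divides 0ℤ refl

  ≈-refl : ∀ {x} → x ≈ x
  ≈-refl {x} = mk≈ (subst (P ∣_) (sym (+-inverseʳ x)) p∣0)

  ≈-reflexive : ∀ {x y} → x ≡ y → x ≈ y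
  ≈-reflexive refl = ≈-refl

  ≈-sym : ∀ {x y} → x ≈ y → y ≈ x
  ≈-sym {x} {y} (mk≈ p∣x-y) = mk≈ (subst (P ∣_) (flip x y) (∣m⇒∣-m p∣x-y))
    where
    flip : ∀ x y → - (x - y) ≡ y - x
    flip = solve-∀

  ≈-trans : ∀ {x y z} → x ≈ y → y ≈ z → x ≈ z
  ≈-trans {x} {y} {z} (mk≈ p∣x-y) (mk≈ p∣y-z) = mk≈ (subst (P ∣_) (telescope x y z) (∣m∣n⇒∣m+n p∣x-y p∣y-z))
    where
    telescope : ∀ x y z → (x - y) + (y - z) ≡ x - z
    telescope = solve-∀

  ≈-setoid : Setoid _ _
  ≈-setoid = record
    { Carrier = ℤ ; _≈_ = _≈_
    ; isEquivalence = record { refl = ≈-refl ; sym = ≈-sym ; trans = ≈-trans } }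

  module ≈-Reasoning = SetoidReasoning ≈-setoid

  infix 4 _≈?_
  _≈?_ : ∀ x y → Dec (x ≈ y)
  x ≈? y = map′ mk≈ p∣x-y (P ∣? x - y)

  p∣⇒≈0 : ∀ {x} → P ∣ x → x ≈ 0ℤ
  p∣⇒≈0 {x} p∣x = mk≈ (subst (P ∣_) (sym (+-identityʳ x)) p∣x)

  ≈0⇒p∣ : ∀ {x} → x ≈ 0ℤ → P ∣ x
  ≈0⇒p∣ {x} (mk≈ p∣x-0) = subst (P ∣_) (+-identityʳ x) p∣x-0

  p∣-resp-≈ : ∀ {x y} → x ≈ y → P ∣ x → P ∣ y
  p∣-resp-≈ x≈y p∣x = ≈0⇒p∣ (≈-trans (≈-sym x≈y) (p∣⇒≈0 p∣x))

  +-cong : ∀ {x x′ y y′} → x ≈ x′ → y ≈ y′ → x + y ≈ x′ + y′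
  +-cong {x} {x′} {y} {y′} (mk≈ p∣dx) (mk≈ p∣dy) = mk≈ (subst (P ∣_) (regroup x x′ y y′) (∣m∣n⇒∣m+n p∣dx p∣dy))
    where
    regroup : ∀ x x′ y y′ → (x - x′) + (y - y′) ≡ (x + y) - (x′ + y′)
    regroup = solve-∀

  -‿cong : ∀ {x y} → x ≈ y → - x ≈ - y
  -‿cong {x} {y} (mk≈ p∣x-y) = mk≈ (subst (P ∣_) (regroup x y) (∣m⇒∣-m p∣x-y))
    where
    regroup : ∀ x y → - (x - y) ≡ - x - - y
    regroup = solve-∀

  -‿cong₂ : ∀ {x x′ y y′} → x ≈ x′ → y ≈ y′ → x - y ≈ x′ - y′
  -‿cong₂ x≈x′ y≈y′ = +-cong x≈x′ (-‿cong y≈y′)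

  -‿cancelˡ : ∀ {x y z} → x - y ≈ x - z → y ≈ z
  -‿cancelˡ {x} {y} {z} (mk≈ p∣Δ) = mk≈ (subst (P ∣_) (regroup x y z) (∣m⇒∣-m p∣Δ))
    where
    regroup : ∀ x y z → - ((x - y) - (x - z)) ≡ y - z
    regroup = solve-∀

  *-cong : ∀ {x x′ y y′} → x ≈ x′ → y ≈ y′ → x * y ≈ x′ * y′
  *-cong {x} {x′} {y} {y′} (mk≈ p∣dx) (mk≈ p∣dy) =
    mk≈ (subst (P ∣_) (regroup x x′ y y′) (∣m∣n⇒∣m+n (∣m⇒∣m*n y p∣dx) (∣n⇒∣m*n x′ p∣dy)))
    where
    regroup : ∀ x x′ y y′ → (x - x′) * y + x′ * (y - y′) ≡ x * y - x′ * y′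
    regroup = solve-∀

  ^-cong : ∀ {x y} n → x ≈ y → x ^ n ≈ y ^ n
  ^-cong zero    x≈y = ≈-refl
  ^-cong (suc n) x≈y = *-cong x≈y (^-cong n x≈y)

  euclid : ∀ {x y} → P ∣ x * y → P ∣ x ⊎ P ∣ y
  euclid {x} {y} p∣xy =
    Sum.map ∣ᵤ⇒∣ ∣ᵤ⇒∣ (euclidsLemma ℤ.∣ x ∣ ℤ.∣ y ∣ p-prime (subst (p ℕ.∣_) (abs-* x y) (∣⇒∣ᵤ p∣xy)))

  p∤* : ∀ {x y} → ¬ P ∣ x → ¬ P ∣ y → ¬ P ∣ x * y
  p∤* p∤x p∤y p∣xy = [ p∤x , p∤y ] (euclid p∣xy)

  p∣c*x⇒p∣x : ∀ {c x} → ¬ P ∣ c → P ∣ c * x → P ∣ x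
  p∣c*x⇒p∣x p∤c p∣cx = [ (λ p∣c → contradiction p∣c p∤c) , (λ p∣x → p∣x) ] (euclid p∣cx)

  p∣x*x⇒p∣x : ∀ {x} → P ∣ x * x → P ∣ x
  p∣x*x⇒p∣x {x} p∣xx = Sum.reduce (euclid {x} {x} p∣xx)

  *-cancelˡ : ∀ {c x y} → ¬ P ∣ c → c * x ≈ c * y → x ≈ y
  *-cancelˡ {c} {x} {y} p∤c (mk≈ p∣cx-cy) = mk≈ (p∣c*x⇒p∣x p∤c (subst (P ∣_) (factor c x y) p∣cx-cy))
    where
    factor : ∀ c x y → c * x - c * y ≡ c * (x - y)
    factor = solve-∀

  p∤small : ∀ {n} → 0 ℕ.< n → n ℕ.< p → ¬ P ∣ + n
  p∤small 0<n n<p p∣n = ℕ.<⇒≱ n<p (ℕ.∣⇒≤ {{ℕ.>-nonZero 0<n}} (∣⇒∣ᵤ p∣n))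

  p∤1 : ¬ P ∣ 1ℤ
  p∤1 = p∤small (s≤s z≤n) (prime>1 p-prime)

  p∣small⇒≡0 : ∀ {n} → n ℕ.< p → P ∣ + n → n ≡ 0
  p∣small⇒≡0 {zero}  _   _   = refl
  p∣small⇒≡0 {suc n} n<p p∣n = contradiction p∣n (p∤small (s≤s z≤n) n<p)

  residue : ℤ → ℕ
  residue x = x ℤ.% P

  residue<p : ∀ x → residue x ℕ.< p
  residue<p x = n%d<d x P

  ≈-residue : ∀ x → x ≈ + residue x
  ≈-residue x = mk≈ (divides (x / P) (begin
    x - + r                    ≡⟨ cong (_- + r) (a≡a%n+[a/n]*n x P) ⟩
    + r + (x / P) * P - + r    ≡⟨ r+y-r≡y (+ r) ((x / P) * P) ⟩
    (x / P) * P                ∎))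
    where
    open ≡-Reasoning
    r = residue x
    r+y-r≡y : ∀ r y → r + y - r ≡ y
    r+y-r≡y = solve-∀

  ≤-residue-unique : ∀ {m n} → n ℕ.≤ m → m ℕ.< p → + m ≈ + n → m ≡ n
  ≤-residue-unique {m} {n} n≤m m<p (mk≈ p∣m-n) = ℕ.≤-antisym (ℕ.m∸n≡0⇒m≤n m∸n≡0) n≤m
    where
    m∸n≡0 : m ℕ.∸ n ≡ 0
    m∸n≡0 = p∣small⇒≡0 (ℕ.≤-<-trans (ℕ.m∸n≤m m n) m<p)
              (subst (P ∣_) (trans (m-n≡m⊖n m n) (⊖-≥ n≤m)) p∣m-n)

  residue-unique : ∀ {m n} → m ℕ.< p → n ℕ.< p → + m ≈ + n → m ≡ n
  residue-unique m<p n<p m≈n with ℕ.≤-total _ _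
  ... | inj₁ n≤m = ≤-residue-unique n≤m m<p m≈n
  ... | inj₂ m≤n = sym (≤-residue-unique m≤n n<p (≈-sym m≈n))

  residue≡⇒≈ : ∀ {x y} → residue x ≡ residue y → x ≈ y
  residue≡⇒≈ {x} {y} eq = ≈-trans (≈-residue x) (≈-trans (≈-reflexive (cong +_ eq)) (≈-sym (≈-residue y)))

  ≈⇒residue≡ : ∀ {x y} → x ≈ y → residue x ≡ residue y
  ≈⇒residue≡ {x} {y} x≈y = residue-unique (residue<p x) (residue<p y)
    (≈-trans (≈-sym (≈-residue x)) (≈-trans x≈y (≈-residue y)))

  fermat-ℕ : ∀ a → (+ a) ^ p ≈ + a
  fermat-ℕ a with fermatℕ p-prime a
  ... | k , a^p≡a+kp = mk≈ (divides (+ k) (begin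
    (+ a) ^ p - + a                ≡⟨ cong (_- + a) (trans (sym (pos-^ a p)) (cong +_ a^p≡a+kp)) ⟩
    + (a ℕ.+ k ℕ.* p) - + a        ≡⟨ cong (_- + a) (trans (pos-+ a (k ℕ.* p)) (cong (_+_ (+ a)) (pos-* k p))) ⟩
    + a + + k * P - + a            ≡⟨ a+kP-a≡kP (+ a) (+ k) P ⟩
    + k * P                        ∎))
    where
    open ≡-Reasoning
    a+kP-a≡kP : ∀ a k P → a + k * P - a ≡ k * P
    a+kP-a≡kP = solve-∀

  fermat : ∀ x → x ^ p ≈ x
  fermat x = begin
    x ^ p                ≈⟨ ^-cong p (≈-residue x) ⟩
    (+ residue x) ^ p    ≈⟨ fermat-ℕ (residue x) ⟩
    + residue x          ≈⟨ ≈-residue x ⟨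
    x                    ∎
    where open ≈-Reasoning

  fermat-iterated : ∀ k x → x ^ (1 ℕ.+ k ℕ.* (p ℕ.∸ 1)) ≈ x
  fermat-iterated zero    x = ≈-reflexive (*-identityʳ x)
  fermat-iterated (suc k) x = begin
    x ^ (1 ℕ.+ (q ℕ.+ k ℕ.* q))   ≡⟨ cong (λ n → x ^ (n ℕ.+ k ℕ.* q)) (ℕ.suc-pred p) ⟩
    x ^ (p ℕ.+ k ℕ.* q)           ≡⟨ ^-distribˡ-+-* x p (k ℕ.* q) ⟩
    x ^ p * x ^ (k ℕ.* q)         ≈⟨ *-cong (fermat x) ≈-refl ⟩
    x * x ^ (k ℕ.* q)             ≈⟨ fermat-iterated k x ⟩
    x                             ∎
    where
    open ≈-Reasoning
    q = p ℕ.∸ 1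

  fermat-unit : ∀ {x} → ¬ P ∣ x → x ^ (p ℕ.∸ 1) ≈ 1ℤ
  fermat-unit {x} p∤x = *-cancelˡ p∤x (begin
    x * x ^ (p ℕ.∸ 1)   ≡⟨ cong (x ^_) (ℕ.suc-pred p) ⟩
    x ^ p               ≈⟨ fermat x ⟩
    x                   ≡⟨ *-identityʳ x ⟨
    x * 1ℤ              ∎)
    where open ≈-Reasoning

  division : ∀ {x} → ¬ P ∣ x → ∀ t → ∃ λ y → x * y ≈ t
  division {x} p∤x t = x ^ (p ℕ.∸ 2) * t , (begin
    x * (x ^ (p ℕ.∸ 2) * t)         ≡⟨ *-assoc x _ t ⟨
    x ^ suc (p ℕ.∸ 2) * t           ≡⟨ cong (λ n → x ^ n * t) (ℕ.+-∸-assoc 1 (prime>1 p-prime)) ⟨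
    x ^ (p ℕ.∸ 1) * t               ≈⟨ *-cong (fermat-unit p∤x) ≈-refl ⟩
    1ℤ * t                          ≡⟨ *-identityˡ t ⟩
    t                               ∎)
    where open ≈-Reasoning

  square≈1⇒≈±1 : ∀ {x} → x * x ≈ 1ℤ → x ≈ 1ℤ ⊎ x ≈ -1ℤ
  square≈1⇒≈±1 {x} (mk≈ p∣x²-1) = Sum.map mk≈ (λ p∣x+1 → mk≈ (subst (P ∣_) (x+1≡x--1 x) p∣x+1))
    (euclid (subst (P ∣_) (x²-1≡[x-1][x+1] x) p∣x²-1))
    where
    x²-1≡[x-1][x+1] : ∀ x → x * x - 1ℤ ≡ (x - 1ℤ) * (x + 1ℤ)
    x²-1≡[x-1][x+1] = solve-∀
    x+1≡x--1 : ∀ x → x + 1ℤ ≡ x - -1ℤ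
    x+1≡x--1 = solve-∀

  module _ (k : ℕ) (p≡4k+3 : p ≡ 4 ℕ.* k ℕ.+ 3) where

    -- Euler's criterion: e = d ^ ((p - 1) / 2) ≈ ±1, and d * e is a square as (p + 1) / 2 is even.
    square-or-minus-square : ∀ {d} → ¬ P ∣ d → ∃ λ x → x * x ≈ d ⊎ x * x ≈ - d
    square-or-minus-square {d} p∤d = d ^ suc k , Sum.map x²≈d x²≈-d (square≈1⇒≈±1 e²≈1)
      where
      E = 2 ℕ.* k ℕ.+ 1
      e = d ^ E
      E+E≡p-1 : E ℕ.+ E ≡ p ℕ.∸ 1
      E+E≡p-1 = begin
        E ℕ.+ E             ≡⟨ [2k+1]+[2k+1]≡4k+2 k ⟩
        4 ℕ.* k ℕ.+ 2       ≡⟨ ℕ.+-∸-assoc (4 ℕ.* k) (s≤s z≤n) ⟨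
        4 ℕ.* k ℕ.+ 3 ℕ.∸ 1 ≡⟨ cong (ℕ._∸ 1) p≡4k+3 ⟨
        p ℕ.∸ 1             ∎
        where
        open ≡-Reasoning
        [2k+1]+[2k+1]≡4k+2 : ∀ k → (2 ℕ.* k ℕ.+ 1) ℕ.+ (2 ℕ.* k ℕ.+ 1) ≡ 4 ℕ.* k ℕ.+ 2
        [2k+1]+[2k+1]≡4k+2 = ℕS.solve-∀
      e²≈1 : e * e ≈ 1ℤ
      e²≈1 = begin
        e * e           ≡⟨ ^-distribˡ-+-* d E E ⟨
        d ^ (E ℕ.+ E)   ≡⟨ cong (d ^_) E+E≡p-1 ⟩
        d ^ (p ℕ.∸ 1)   ≈⟨ fermat-unit p∤d ⟩
        1ℤ              ∎
        where open ≈-Reasoning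
      x²≡d*e : d ^ suc k * d ^ suc k ≡ d * e
      x²≡d*e = trans (sym (^-distribˡ-+-* d (suc k) (suc k))) (cong (λ n → d ^ suc n) (k+[1+k]≡2k+1 k))
        where
        k+[1+k]≡2k+1 : ∀ k → k ℕ.+ suc k ≡ 2 ℕ.* k ℕ.+ 1
        k+[1+k]≡2k+1 = ℕS.solve-∀
      x²≈d : e ≈ 1ℤ → d ^ suc k * d ^ suc k ≈ d
      x²≈d e≈1 = begin
        d ^ suc k * d ^ suc k  ≡⟨ x²≡d*e ⟩
        d * e                  ≈⟨ *-cong (≈-refl {d}) e≈1 ⟩
        d * 1ℤ                 ≡⟨ *-identityʳ d ⟩
        d                      ∎
        where open ≈-Reasoning
      x²≈-d : e ≈ -1ℤ → d ^ suc k * d ^ suc k ≈ - d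
      x²≈-d e≈-1 = begin
        d ^ suc k * d ^ suc k  ≡⟨ x²≡d*e ⟩
        d * e                  ≈⟨ *-cong (≈-refl {d}) e≈-1 ⟩
        d * -1ℤ                ≡⟨ *-comm d -1ℤ ⟩
        -1ℤ * d                ≡⟨ -1*i≡-i d ⟩
        - d                    ∎
        where open ≈-Reasoning

  module _ (n : ℕ) (p≡3n+2 : p ≡ 3 ℕ.* n ℕ.+ 2) where

    cube-root : ∀ x → (x ^ 3) ^ (2 ℕ.* n ℕ.+ 1) ≈ x
    cube-root x = begin
      (x ^ 3) ^ (2 ℕ.* n ℕ.+ 1)       ≡⟨ ^-*-assoc x 3 (2 ℕ.* n ℕ.+ 1) ⟩
      x ^ (3 ℕ.* (2 ℕ.* n ℕ.+ 1))     ≡⟨ cong (x ^_) exponent ⟩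
      x ^ (1 ℕ.+ 2 ℕ.* (p ℕ.∸ 1))     ≈⟨ fermat-iterated 2 x ⟩
      x                               ∎
      where
      open ≈-Reasoning
      exponent : 3 ℕ.* (2 ℕ.* n ℕ.+ 1) ≡ 1 ℕ.+ 2 ℕ.* (p ℕ.∸ 1)
      exponent = trans (3[2n+1]≡1+2[3n+1] n)
        (cong (λ m → 1 ℕ.+ 2 ℕ.* m) (sym (trans (cong (ℕ._∸ 1) p≡3n+2) (ℕ.+-∸-assoc (3 ℕ.* n) (s≤s z≤n)))))
        where
        3[2n+1]≡1+2[3n+1] : ∀ n → 3 ℕ.* (2 ℕ.* n ℕ.+ 1) ≡ 1 ℕ.+ 2 ℕ.* (3 ℕ.* n ℕ.+ 1)
        3[2n+1]≡1+2[3n+1] = ℕS.solve-∀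

    cube-injective : ∀ {x y} → x ^ 3 ≈ y ^ 3 → x ≈ y
    cube-injective {x} {y} x³≈y³ =
      ≈-trans (≈-sym (cube-root x)) (≈-trans (^-cong (2 ℕ.* n ℕ.+ 1) x³≈y³) (cube-root y))

  module _ (n : ℕ) (p≡6n+5 : p ≡ 6 ℕ.* n ℕ.+ 5) where

    -- -3 is not a square: for X = x - y and Y = 2y, x² + 3y² = X² + XY + Y² divides X³ - Y³.
    p∣x²+3y²⇒p∣y : ∀ {x y} → P ∣ x * x + + 3 * (y * y) → P ∣ y
    p∣x²+3y²⇒p∣y {x} {y} p∣x²+3y² = p∣c*x⇒p∣x p∤2 (p∣x*x⇒p∣x (p∣c*x⇒p∣x p∤3 p∣3Y²))
      where
      3<p : 3 ℕ.< p
      3<p = subst (3 ℕ.<_) (sym p≡6n+5) (ℕ.≤-trans (s≤s (s≤s (s≤s (s≤s z≤n)))) (ℕ.m≤n+m 5 (6 ℕ.* n)))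
      p∤2 : ¬ P ∣ + 2
      p∤2 = p∤small (s≤s z≤n) (ℕ.<-trans (s≤s (s≤s (s≤s z≤n))) 3<p)
      p∤3 : ¬ P ∣ + 3
      p∤3 = p∤small (s≤s z≤n) 3<p
      X = x - y
      Y = + 2 * y
      p∣X²+XY+Y² : P ∣ X * X + X * Y + Y * Y
      p∣X²+XY+Y² = subst (P ∣_) (substitute x y) p∣x²+3y²
        where
        substitute : ∀ x y → x * x + + 3 * (y * y) ≡ (x - y) * (x - y) + (x - y) * (+ 2 * y) + (+ 2 * y) * (+ 2 * y)
        substitute = solve-∀
      X≈Y : X ≈ Y
      X≈Y = cube-injective (2 ℕ.* n ℕ.+ 1) p≡3[2n+1]+2 {X} {Y}
        (mk≈ (subst (P ∣_) (cubes X Y) (∣n⇒∣m*n (X - Y) p∣X²+XY+Y²)))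
        where
        cubes : ∀ X Y → (X - Y) * (X * X + X * Y + Y * Y) ≡ X * (X * (X * 1ℤ)) - Y * (Y * (Y * 1ℤ))
        cubes = solve-∀
        p≡3[2n+1]+2 : p ≡ 3 ℕ.* (2 ℕ.* n ℕ.+ 1) ℕ.+ 2
        p≡3[2n+1]+2 = trans p≡6n+5 (6n+5≡3[2n+1]+2 n)
          where
          6n+5≡3[2n+1]+2 : ∀ n → 6 ℕ.* n ℕ.+ 5 ≡ 3 ℕ.* (2 ℕ.* n ℕ.+ 1) ℕ.+ 2
          6n+5≡3[2n+1]+2 = ℕS.solve-∀
      p∣3Y² : P ∣ + 3 * (Y * Y)
      p∣3Y² = subst (P ∣_) (reduce X Y) (∣m∣n⇒∣m-n p∣X²+XY+Y² (∣n⇒∣m*n (X + + 2 * Y) (p∣x-y X≈Y)))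
        where
        reduce : ∀ X Y → X * X + X * Y + Y * Y - (X + + 2 * Y) * (X - Y) ≡ + 3 * (Y * Y)
        reduce = solve-∀

module SignedIntegers where

  open import Data.Integer using (ℤ; -_; _+_; _-_)
  open import Data.Integer.Properties using (neg-distrib-+; neg-involutive)
  open import Data.Integer.Tactic.RingSolver using (solve-∀)
  open import Data.Sign as Sign using (Sign; opposite)
  open import Relation.Binary.PropositionalEquality

  infixr 8 _·_
  _·_ : Sign → ℤ → ℤ
  Sign.+ · x = x
  Sign.- · x = - x

  ·-distrib-+ : ∀ σ x y → σ · x + σ · y ≡ σ · (x + y)
  ·-distrib-+ Sign.+ x y = refl
  ·-distrib-+ Sign.- x y = sym (neg-distrib-+ x y)

  ·-distrib-opposite : ∀ σ x y → σ · x + opposite σ · y ≡ σ · (x - y)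
  ·-distrib-opposite Sign.+ x y = refl
  ·-distrib-opposite Sign.- x y = -x+y≡-[x-y] x y
    where
    -x+y≡-[x-y] : ∀ x y → - x + y ≡ - (x - y)
    -x+y≡-[x-y] = solve-∀

  neg-· : ∀ σ x → - (σ · x) ≡ opposite σ · x
  neg-· Sign.+ x = refl
  neg-· Sign.- x = neg-involutive x

  ·-involutive : ∀ σ x → σ · σ · x ≡ x
  ·-involutive Sign.+ x = refl
  ·-involutive Sign.- x = neg-involutive x

module Shapes where

  open import Data.Nat using (zero; suc; _<ᵇ_)
  open import Data.Sign as Sign using (Sign; opposite)
  open import Data.Bool as Bool using (Bool)
  open import Data.Fin using (Fin)
  open import Data.Fin.Patterns using (0F; 1F; 2F; 3F; 4F; 5F)
  open import Relation.Binary.PropositionalEquality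

  <ᵇ-flip⇒≡ : ∀ m n → (m <ᵇ n) ≡ (n <ᵇ m) → m ≡ n
  <ᵇ-flip⇒≡ zero    zero    _  = refl
  <ᵇ-flip⇒≡ (suc m) (suc n) eq = cong suc (<ᵇ-flip⇒≡ m n eq)

  data Shape : Set where
    same  : Sign → Bool → Shape
    mixed : Sign → Shape

  shape : Sign → Sign → Bool → Shape
  shape Sign.+ Sign.+ b = same Sign.+ b
  shape Sign.- Sign.- b = same Sign.- b
  shape Sign.+ Sign.- _ = mixed Sign.+
  shape Sign.- Sign.+ _ = mixed Sign.-

  signs : Shape → Sign × Sign
  signs (same σ _) = σ , σ
  signs (mixed σ)  = σ , opposite σ

  tiebreak : Shape → Bool
  tiebreak (same _ b) = b
  tiebreak (mixed _)  = Bool.false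

  signs-shape : ∀ σ τ b → signs (shape σ τ b) ≡ (σ , τ)
  signs-shape Sign.+ Sign.+ b = refl
  signs-shape Sign.- Sign.- b = refl
  signs-shape Sign.+ Sign.- b = refl
  signs-shape Sign.- Sign.+ b = refl

  tiebreak-shape : ∀ σ b → tiebreak (shape σ σ b) ≡ b
  tiebreak-shape Sign.+ b = refl
  tiebreak-shape Sign.- b = refl

  shape-injective : ∀ {σ τ b σ′ τ′ b′} → shape σ τ b ≡ shape σ′ τ′ b′ →
    σ ≡ σ′ × τ ≡ τ′ × (σ ≡ τ → b ≡ b′)
  shape-injective {σ} {τ} {b} {σ′} {τ′} {b′} eq
    with trans (sym (signs-shape σ τ b)) (trans (cong signs eq) (signs-shape σ′ τ′ b′))
  ... | refl = refl , refl , λ where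
    refl → trans (sym (tiebreak-shape σ b)) (trans (cong tiebreak eq) (tiebreak-shape σ b′))

  shape-index : Shape → Fin 6
  shape-index (same Sign.+ Bool.false) = 0F
  shape-index (same Sign.+ Bool.true)  = 1F
  shape-index (same Sign.- Bool.false) = 2F
  shape-index (same Sign.- Bool.true)  = 3F
  shape-index (mixed Sign.+)           = 4F
  shape-index (mixed Sign.-)           = 5F

  index-shape : Fin 6 → Shape
  index-shape 0F = same Sign.+ Bool.false
  index-shape 1F = same Sign.+ Bool.true
  index-shape 2F = same Sign.- Bool.false
  index-shape 3F = same Sign.- Bool.true
  index-shape 4F = mixed Sign.+
  index-shape 5F = mixed Sign.-

  index-shape-index : ∀ x → index-shape (shape-index x) ≡ x
  index-shape-index (same Sign.+ Bool.false) = refl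
  index-shape-index (same Sign.+ Bool.true)  = refl
  index-shape-index (same Sign.- Bool.false) = refl
  index-shape-index (same Sign.- Bool.true)  = refl
  index-shape-index (mixed Sign.+)           = refl
  index-shape-index (mixed Sign.-)           = refl

  shape-index-injective : ∀ {x y} → shape-index x ≡ shape-index y → x ≡ y
  shape-index-injective {x} {y} eq = trans (sym (index-shape-index x)) (trans (cong index-shape eq) (index-shape-index y))

module Parabolas {p : ℕ} (p-prime : Prime p) (p%12≡11 : p % 12 ≡ 11) where

  open import Data.Nat as ℕ using (z≤n; s≤s; _<ᵇ_)
  import Data.Nat.Properties as ℕ
  open import Data.Nat.DivMod using (m≡m%n+[m/n]*n)
  import Data.Nat.Tactic.RingSolver as ℕS
  open import Data.Integer hiding (_%_; ∣_∣; suc; pred; sign; NonZero)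
  open import Data.Integer.Properties
  open import Data.Integer.Divisibility.Signed
  open import Data.Integer.Tactic.RingSolver using (solve-∀)
  open import Data.Sign as Sign using (Sign; opposite)
  open import Data.Product using (∃; ∃₂; _,_; proj₁; proj₂)
  open import Data.Sum as Sum using (_⊎_; inj₁; inj₂; [_,_])
  open import Relation.Nullary using (¬_; Dec; yes; no)
  open import Relation.Nullary.Decidable using (map′; ¬?; _×-dec_; _⊎-dec_)
  open import Relation.Binary.PropositionalEquality hiding ([_])

  open Congruence p-prime
  open SignedIntegers
  open Shapes

  m = p ℕ./ 12

  p≡12m+11 : p ≡ 12 ℕ.* m ℕ.+ 11
  p≡12m+11 = trans (m≡m%n+[m/n]*n p 12) (trans (cong (ℕ._+ m ℕ.* 12) p%12≡11) (11+m*12≡12m+11 m))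
    where
    11+m*12≡12m+11 : ∀ m → 11 ℕ.+ m ℕ.* 12 ≡ 12 ℕ.* m ℕ.+ 11
    11+m*12≡12m+11 = ℕS.solve-∀

  p≡4k+3 : p ≡ 4 ℕ.* (3 ℕ.* m ℕ.+ 2) ℕ.+ 3
  p≡4k+3 = trans p≡12m+11 (12m+11≡4[3m+2]+3 m)
    where
    12m+11≡4[3m+2]+3 : ∀ m → 12 ℕ.* m ℕ.+ 11 ≡ 4 ℕ.* (3 ℕ.* m ℕ.+ 2) ℕ.+ 3
    12m+11≡4[3m+2]+3 = ℕS.solve-∀

  p≡6n+5 : p ≡ 6 ℕ.* (2 ℕ.* m ℕ.+ 1) ℕ.+ 5
  p≡6n+5 = trans p≡12m+11 (12m+11≡6[2m+1]+5 m)
    where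
    12m+11≡6[2m+1]+5 : ∀ m → 12 ℕ.* m ℕ.+ 11 ≡ 6 ℕ.* (2 ℕ.* m ℕ.+ 1) ℕ.+ 5
    12m+11≡6[2m+1]+5 = ℕS.solve-∀

  p∤2 : ¬ P ∣ + 2
  p∤2 = p∤small (s≤s z≤n)
    (subst (2 ℕ.<_) (sym p≡12m+11) (ℕ.≤-trans (s≤s (s≤s (s≤s z≤n))) (ℕ.m≤n+m 11 (12 ℕ.* m))))

  ·-cong : ∀ σ {x y} → x ≈ y → σ · x ≈ σ · y
  ·-cong Sign.+ x≈y = x≈y
  ·-cong Sign.- x≈y = -‿cong x≈y

  ·-cancel : ∀ σ {x y} → σ · x ≈ σ · y → x ≈ y
  ·-cancel σ {x} {y} σx≈σy = begin
    x            ≡⟨ ·-involutive σ x ⟨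
    σ · σ · x    ≈⟨ ·-cong σ σx≈σy ⟩
    σ · σ · y    ≡⟨ ·-involutive σ y ⟩
    y            ∎
    where open ≈-Reasoning

  p∣⇒p∣σ· : ∀ σ {x} → P ∣ x → P ∣ σ · x
  p∣⇒p∣σ· Sign.+ p∣x = p∣x
  p∣⇒p∣σ· Sign.- p∣x = ∣m⇒∣-m p∣x

  signed-square : ∀ {d} → ¬ P ∣ d → ∃₂ λ σ x → σ · (x * x) ≈ d
  signed-square {d} p∤d = signed (square-or-minus-square (3 ℕ.* m ℕ.+ 2) p≡4k+3 p∤d)
    where
    signed : (∃ λ x → x * x ≈ d ⊎ x * x ≈ - d) → ∃₂ λ σ x → σ · (x * x) ≈ d
    signed (x , inj₁ x²≈d)  = Sign.+ , x , x²≈d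
    signed (x , inj₂ x²≈-d) = Sign.- , x , ≈-trans (-‿cong x²≈-d) (≈-reflexive (neg-involutive d))

  record InA (x y : ℤ) : Set where
    constructor inA
    field
      nonzero     : ¬ P ∣ x
      sign        : Sign
      on-parabola : y ≈ sign · (x * x)
  open InA public

  InA-resp : ∀ {x x′ y y′} → x ≈ x′ → y ≈ y′ → InA x y → InA x′ y′
  InA-resp x≈x′ y≈y′ (inA p∤x σ y≈σx²) = inA
    (λ p∣x′ → p∤x (p∣-resp-≈ (≈-sym x≈x′) p∣x′)) σ
    (≈-trans (≈-sym y≈y′) (≈-trans y≈σx² (·-cong σ (*-cong x≈x′ x≈x′))))

  InA-neg : ∀ {x y} → InA x y → InA (- x) (- y)
  InA-neg {x} {y} (inA p∤x σ y≈σx²) = inA (λ p∣-x → p∤x (subst (P ∣_) (neg-involutive x) (∣m⇒∣-m p∣-x)))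
    (opposite σ) (begin
      - y                       ≈⟨ -‿cong y≈σx² ⟩
      - (σ · (x * x))           ≡⟨ neg-· σ (x * x) ⟩
      opposite σ · (x * x)      ≡⟨ cong (opposite σ ·_) (-x*-x≡x*x x) ⟨
      opposite σ · (- x * - x)  ∎)
    where
    open ≈-Reasoning
    -x*-x≡x*x : ∀ x → - x * - x ≡ x * x
    -x*-x≡x*x = solve-∀

  InA? : ∀ x y → Dec (InA x y)
  InA? x y = map′ to from (¬? (P ∣? x) ×-dec (y ≈? x * x ⊎-dec y ≈? - (x * x)))
    where
    to : ¬ P ∣ x × (y ≈ x * x ⊎ y ≈ - (x * x)) → InA x y
    to (p∤x , inj₁ on) = inA p∤x Sign.+ on
    to (p∤x , inj₂ on) = inA p∤x Sign.- on
    from : InA x y → ¬ P ∣ x × (y ≈ x * x ⊎ y ≈ - (x * x))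
    from (inA p∤x Sign.+ on) = p∤x , inj₁ on
    from (inA p∤x Sign.- on) = p∤x , inj₂ on

  p∤2xy : ∀ {x y} → ¬ P ∣ x → ¬ P ∣ y → ¬ P ∣ + 2 * (x * y)
  p∤2xy p∤x p∤y = p∤* p∤2 (p∤* p∤x p∤y)

  -- Each sign pattern makes a product of non-zero factors vanish, except a² + b² = -(a + b)²,
  -- which reads (2a + b)² + 3b² = 0 and is excluded because -3 is not a square.
  squares-sum-free : ∀ τ ρ {a b} → ¬ P ∣ a → ¬ P ∣ b → ¬ P ∣ a + b →
    ¬ a * a + τ · (b * b) ≈ ρ · ((a + b) * (a + b))
  squares-sum-free Sign.+ Sign.+ {a} {b} p∤a p∤b _ eq =
    p∤2xy p∤a p∤b (subst (P ∣_) ([a+b]²-a²-b²≡2ab a b) (p∣x-y (≈-sym eq)))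
    where
    [a+b]²-a²-b²≡2ab : ∀ a b → (a + b) * (a + b) - (a * a + b * b) ≡ + 2 * (a * b)
    [a+b]²-a²-b²≡2ab = solve-∀
  squares-sum-free Sign.+ Sign.- {a} {b} p∤a p∤b _ eq =
    p∤b (p∣x²+3y²⇒p∣y (2 ℕ.* m ℕ.+ 1) p≡6n+5 {+ 2 * a + b}
      (subst (P ∣_) (complete-square a b) (∣n⇒∣m*n (+ 2) (p∣x-y eq))))
    where
    complete-square : ∀ a b → + 2 * (a * a + b * b - - ((a + b) * (a + b)))
                              ≡ (+ 2 * a + b) * (+ 2 * a + b) + + 3 * (b * b)
    complete-square = solve-∀
  squares-sum-free Sign.- Sign.+ {a} {b} p∤a p∤b p∤a+b eq =
    p∤2xy p∤b p∤a+b (subst (P ∣_) ([a+b]²-a²+b²≡2b[a+b] a b) (p∣x-y (≈-sym eq)))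
    where
    [a+b]²-a²+b²≡2b[a+b] : ∀ a b → (a + b) * (a + b) - (a * a + - (b * b)) ≡ + 2 * (b * (a + b))
    [a+b]²-a²+b²≡2b[a+b] = solve-∀
  squares-sum-free Sign.- Sign.- {a} {b} p∤a p∤b p∤a+b eq =
    p∤2xy p∤a p∤a+b (subst (P ∣_) (a²-b²+[a+b]²≡2a[a+b] a b) (p∣x-y eq))
    where
    a²-b²+[a+b]²≡2a[a+b] : ∀ a b → a * a + - (b * b) - - ((a + b) * (a + b)) ≡ + 2 * (a * (a + b))
    a²-b²+[a+b]²≡2a[a+b] = solve-∀

  signed-squares-sum-free : ∀ σ τ ρ {a b} → ¬ P ∣ a → ¬ P ∣ b → ¬ P ∣ a + b →
    ¬ σ · (a * a) + τ · (b * b) ≈ ρ · ((a + b) * (a + b))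
  signed-squares-sum-free Sign.+ = squares-sum-free
  signed-squares-sum-free Sign.- τ ρ {a} {b} p∤a p∤b p∤a+b eq =
    squares-sum-free (opposite τ) (opposite ρ) p∤a p∤b p∤a+b (begin
      a * a + opposite τ · (b * b)        ≡⟨ cong₂ _+_ (neg-involutive (a * a)) (neg-· τ (b * b)) ⟨
      - - (a * a) + - (τ · (b * b))       ≡⟨ neg-distrib-+ (- (a * a)) (τ · (b * b)) ⟨
      - (- (a * a) + τ · (b * b))         ≈⟨ -‿cong eq ⟩
      - (ρ · ((a + b) * (a + b)))         ≡⟨ neg-· ρ _ ⟩
      opposite ρ · ((a + b) * (a + b))    ∎)
    where open ≈-Reasoning

  sum-free : ∀ {a₁ a₂ b₁ b₂} → InA a₁ a₂ → InA b₁ b₂ → ¬ InA (a₁ + b₁) (a₂ + b₂)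
  sum-free (inA p∤a σ a₂≈σa²) (inA p∤b τ b₂≈τb²) (inA p∤a+b ρ a₂+b₂≈ρ[a+b]²) =
    signed-squares-sum-free σ τ ρ p∤a p∤b p∤a+b (≈-trans (≈-sym (+-cong a₂≈σa² b₂≈τb²)) a₂+b₂≈ρ[a+b]²)


  record Decomposition (s t : ℤ) : Set where
    constructor decomposition
    field
      {a₁ a₂ c₁ c₂} : ℤ
      a∈A  : InA a₁ a₂
      c∈A  : InA c₁ c₂
      sum₁ : a₁ + c₁ ≈ s
      sum₂ : a₂ + c₂ ≈ t
  open Decomposition public

  -- s = α + γ and t = α² - γ², solved for α from 2sα = s² + t.
  mixed-decomposition : ∀ {s t} → ¬ P ∣ s → ¬ InA s t → Decomposition s t
  mixed-decomposition {s} {t} p∤s s,t∉A =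
    decomposition (inA p∤α Sign.+ ≈-refl) (inA p∤γ Sign.- ≈-refl) α+γ≈s α²-γ²≈t
    where
    open ≈-Reasoning
    solution : ∃ λ α → + 2 * s * α ≈ s * s + t
    solution = division (p∤* p∤2 p∤s) (s * s + t)
    α = proj₁ solution
    γ = s - α
    α+γ≈s : α + γ ≈ s
    α+γ≈s = ≈-reflexive (α+[s-α]≡s α s)
      where
      α+[s-α]≡s : ∀ α s → α + (s - α) ≡ s
      α+[s-α]≡s = solve-∀
    α²-γ²≈t : α * α - γ * γ ≈ t
    α²-γ²≈t = begin
      α * α - γ * γ                 ≡⟨ expand α s ⟩
      + 2 * s * α - s * s           ≈⟨ -‿cong₂ (proj₂ solution) (≈-refl {s * s}) ⟩
      s * s + t - s * s             ≡⟨ cancel (s * s) t ⟩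
      t                             ∎
      where
      expand : ∀ α s → α * α - (s - α) * (s - α) ≡ + 2 * s * α - s * s
      expand = solve-∀
      cancel : ∀ x t → x + t - x ≡ t
      cancel = solve-∀
    p∤α : ¬ P ∣ α
    p∤α p∣α = s,t∉A (inA p∤s Sign.- (begin
      t                    ≈⟨ α²-γ²≈t ⟨
      α * α - γ * γ        ≈⟨ -‿cong₂ (*-cong α≈0 α≈0) (*-cong γ≈s γ≈s) ⟩
      0ℤ * 0ℤ - s * s      ≡⟨ 0-x≡-x (s * s) ⟩
      - (s * s)            ∎))
      where
      α≈0 : α ≈ 0ℤ
      α≈0 = p∣⇒≈0 p∣α
      γ≈s : γ ≈ s
      γ≈s = ≈-trans (-‿cong₂ (≈-refl {s}) α≈0) (≈-reflexive (+-identityʳ s))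
      0-x≡-x : ∀ x → 0ℤ * 0ℤ - x ≡ - x
      0-x≡-x = solve-∀
    p∤γ : ¬ P ∣ γ
    p∤γ p∣γ = s,t∉A (inA p∤s Sign.+ (begin
      t                    ≈⟨ α²-γ²≈t ⟨
      α * α - γ * γ        ≈⟨ -‿cong₂ (*-cong α≈s α≈s) (*-cong γ≈0 γ≈0) ⟩
      s * s - 0ℤ * 0ℤ      ≡⟨ x-0≡x (s * s) ⟩
      s * s                ∎))
      where
      γ≈0 : γ ≈ 0ℤ
      γ≈0 = p∣⇒≈0 p∣γ
      α≈s : α ≈ s
      α≈s = ≈-trans (≈-reflexive (s-[s-α]≡α s α)) (≈-trans (-‿cong₂ (≈-refl {s}) γ≈0) (≈-reflexive (+-identityʳ s)))
        where
        s-[s-α]≡α : ∀ s α → α ≡ s - (s - α)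
        s-[s-α]≡α = solve-∀
      x-0≡x : ∀ x → x - 0ℤ * 0ℤ ≡ x
      x-0≡x = solve-∀

  opposite-decomposition : ∀ {s t} → P ∣ s → ¬ P ∣ t → Decomposition s t
  opposite-decomposition {s} {t} p∣s p∤t =
    decomposition (inA p∤x σ ≈-refl) (inA p∤-x σ (≈-reflexive (cong (σ ·_) (sym (-x*-x≡x*x x)))))
      (≈-trans (≈-reflexive (+-inverseʳ x)) (≈-sym (p∣⇒≈0 p∣s)))
      (begin
        σ · (x * x) + σ · (x * x)    ≈⟨ +-cong σx²≈δ σx²≈δ ⟩
        δ + δ                        ≡⟨ δ+δ≡2δ δ ⟩
        + 2 * δ                      ≈⟨ proj₂ half ⟩
        t                            ∎)
    where
    open ≈-Reasoning
    half : ∃ λ δ → + 2 * δ ≈ t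
    half = division p∤2 t
    δ = proj₁ half
    p∤δ : ¬ P ∣ δ
    p∤δ p∣δ = p∤t (p∣-resp-≈ (proj₂ half) (∣n⇒∣m*n (+ 2) p∣δ))
    root = signed-square p∤δ
    σ = proj₁ root
    x = proj₁ (proj₂ root)
    σx²≈δ : σ · (x * x) ≈ δ
    σx²≈δ = proj₂ (proj₂ root)
    p∤x : ¬ P ∣ x
    p∤x p∣x = p∤δ (p∣-resp-≈ σx²≈δ (p∣⇒p∣σ· σ (∣n⇒∣m*n x p∣x)))
    p∤-x : ¬ P ∣ - x
    p∤-x p∣-x = p∤x (subst (P ∣_) (neg-involutive x) (∣m⇒∣-m p∣-x))
    -x*-x≡x*x : ∀ x → - x * - x ≡ x * x
    -x*-x≡x*x = solve-∀
    δ+δ≡2δ : ∀ δ → δ + δ ≡ + 2 * δ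
    δ+δ≡2δ = solve-∀

  decompose : ∀ {s t} → ¬ (P ∣ s × P ∣ t) → ¬ InA s t → Decomposition s t
  decompose {s} {t} s,t≉0 s,t∉A with P ∣? s
  ... | no  p∤s = mixed-decomposition p∤s s,t∉A
  ... | yes p∣s = opposite-decomposition p∣s (λ p∣t → s,t≉0 (p∣s , p∣t))

  same-sum-and-sum-of-squares : ∀ {a c a′ c′} → a + c ≈ a′ + c′ → a * a + c * c ≈ a′ * a′ + c′ * c′ →
    a ≈ a′ ⊎ a ≈ c′
  same-sum-and-sum-of-squares {a} {c} {a′} {c′} (mk≈ p∣Δsum) (mk≈ p∣Δsquares) =
    Sum.map mk≈ mk≈ (euclid (p∣c*x⇒p∣x p∤2 (subst (P ∣_) (vieta a c a′ c′)
      (∣m∣n⇒∣m+n (∣m⇒∣m*n _ p∣Δsum) p∣Δsquares))))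
    where
    vieta : ∀ a c a′ c′ → ((a + c) - (a′ + c′)) * (((a + c) - (a′ + c′)) - + 2 * c)
                          + ((a * a + c * c) - (a′ * a′ + c′ * c′)) ≡ + 2 * ((a - a′) * (a - c′))
    vieta = solve-∀

  same-sum-and-difference-of-squares : ∀ {a c a′ c′} → ¬ P ∣ a + c → a + c ≈ a′ + c′ →
    a * a - c * c ≈ a′ * a′ - c′ * c′ → a ≈ a′
  same-sum-and-difference-of-squares {a} {c} {a′} {c′} p∤a+c (mk≈ p∣Δsum) (mk≈ p∣Δdifferences) =
    mk≈ (p∣c*x⇒p∣x p∤2 (subst (P ∣_) (recombine a c a′ c′) (∣m∣n⇒∣m+n p∣Δdifference p∣Δsum)))
    where
    factor : ∀ a c a′ c′ → (a * a - c * c) - (a′ * a′ - c′ * c′) - (a′ - c′) * ((a + c) - (a′ + c′))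
                           ≡ (a + c) * (a - c - (a′ - c′))
    factor = solve-∀
    p∣Δdifference : P ∣ a - c - (a′ - c′)
    p∣Δdifference = p∣c*x⇒p∣x p∤a+c (subst (P ∣_) (factor a c a′ c′)
      (∣m∣n⇒∣m-n p∣Δdifferences (∣n⇒∣m*n (a′ - c′) p∣Δsum)))
    recombine : ∀ a c a′ c′ → (a - c - (a′ - c′)) + ((a + c) - (a′ + c′)) ≡ + 2 * (a - a′)
    recombine = solve-∀

  cross-cancel : ∀ {a c a′ c′} → a + c ≈ a′ + c′ → a ≈ c′ → c ≈ a′
  cross-cancel {a} {c} {a′} {c′} (mk≈ p∣Δsum) (mk≈ p∣a-c′) =
    mk≈ (subst (P ∣_) (regroup a c a′ c′) (∣m∣n⇒∣m-n p∣Δsum p∣a-c′))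
    where
    regroup : ∀ a c a′ c′ → (a + c) - (a′ + c′) - (a - c′) ≡ c - a′
    regroup = solve-∀

  same-signs-unique : ∀ σ {s t a c a′ c′} →
    a + c ≈ s → σ · (a * a) + σ · (c * c) ≈ t →
    a′ + c′ ≈ s → σ · (a′ * a′) + σ · (c′ * c′) ≈ t →
    (residue a <ᵇ residue c) ≡ (residue a′ <ᵇ residue c′) → a ≈ a′
  same-signs-unique σ {a = a} {c} {a′} {c′} a+c≈s σ-sum a′+c′≈s σ-sum′ tie =
    [ (λ a≈a′ → a≈a′) , swapped ] (same-sum-and-sum-of-squares sums (·-cancel σ (begin
      σ · (a * a + c * c)              ≡⟨ ·-distrib-+ σ _ _ ⟨
      σ · (a * a) + σ · (c * c)        ≈⟨ ≈-trans σ-sum (≈-sym σ-sum′) ⟩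
      σ · (a′ * a′) + σ · (c′ * c′)    ≡⟨ ·-distrib-+ σ _ _ ⟩
      σ · (a′ * a′ + c′ * c′)          ∎)))
    where
    open ≈-Reasoning
    sums : a + c ≈ a′ + c′
    sums = ≈-trans a+c≈s (≈-sym a′+c′≈s)
    swapped : a ≈ c′ → a ≈ a′
    swapped a≈c′ = ≈-trans (residue≡⇒≈ ra≡rc) c≈a′
      where
      c≈a′ : c ≈ a′
      c≈a′ = cross-cancel sums a≈c′
      ra≡rc : residue a ≡ residue c
      ra≡rc = <ᵇ-flip⇒≡ (residue a) (residue c)
        (trans tie (cong₂ _<ᵇ_ (≈⇒residue≡ (≈-sym c≈a′)) (≈⇒residue≡ (≈-sym a≈c′))))

  opposite-signs-unique : ∀ σ {s t a c a′ c′} → ¬ (P ∣ s × P ∣ t) →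
    a + c ≈ s → σ · (a * a) + opposite σ · (c * c) ≈ t →
    a′ + c′ ≈ s → σ · (a′ * a′) + opposite σ · (c′ * c′) ≈ t → a ≈ a′
  opposite-signs-unique σ {s} {t} {a} {c} {a′} {c′} s,t≉0 a+c≈s σ-sum a′+c′≈s σ-sum′ =
    same-sum-and-difference-of-squares p∤a+c (≈-trans a+c≈s (≈-sym a′+c′≈s)) (·-cancel σ (begin
      σ · (a * a - c * c)                    ≡⟨ ·-distrib-opposite σ _ _ ⟨
      σ · (a * a) + opposite σ · (c * c)     ≈⟨ ≈-trans σ-sum (≈-sym σ-sum′) ⟩
      σ · (a′ * a′) + opposite σ · (c′ * c′) ≡⟨ ·-distrib-opposite σ _ _ ⟩
      σ · (a′ * a′ - c′ * c′)                ∎))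
    where
    open ≈-Reasoning
    p∤a+c : ¬ P ∣ a + c
    p∤a+c p∣a+c = s,t≉0 (p∣-resp-≈ a+c≈s p∣a+c , p∣-resp-≈ σ-difference≈t p∣σ-difference)
      where
      σ-difference≈t : σ · (a * a - c * c) ≈ t
      σ-difference≈t = ≈-trans (≈-reflexive (sym (·-distrib-opposite σ _ _))) σ-sum
      difference-of-squares : ∀ a c → (a + c) * (a - c) ≡ a * a - c * c
      difference-of-squares = solve-∀
      p∣σ-difference : P ∣ σ · (a * a - c * c)
      p∣σ-difference = p∣⇒p∣σ· σ (subst (P ∣_) (difference-of-squares a c) (∣m⇒∣m*n (a - c) p∣a+c))

  first-summand-unique : ∀ {σ τ σ′ τ′ s t a c a′ c′} → ¬ (P ∣ s × P ∣ t) →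
    σ ≡ σ′ → τ ≡ τ′ → (σ ≡ τ → (residue a <ᵇ residue c) ≡ (residue a′ <ᵇ residue c′)) →
    a + c ≈ s → σ · (a * a) + τ · (c * c) ≈ t →
    a′ + c′ ≈ s → σ′ · (a′ * a′) + τ′ · (c′ * c′) ≈ t → a ≈ a′
  first-summand-unique {Sign.+} {Sign.+} _ refl refl tie a+c≈s sum a′+c′≈s sum′ =
    same-signs-unique Sign.+ a+c≈s sum a′+c′≈s sum′ (tie refl)
  first-summand-unique {Sign.-} {Sign.-} _ refl refl tie a+c≈s sum a′+c′≈s sum′ =
    same-signs-unique Sign.- a+c≈s sum a′+c′≈s sum′ (tie refl)
  first-summand-unique {Sign.+} {Sign.-} s,t≉0 refl refl _ = opposite-signs-unique Sign.+ s,t≉0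
  first-summand-unique {Sign.-} {Sign.+} s,t≉0 refl refl _ = opposite-signs-unique Sign.- s,t≉0

  -- The tiebreak separates a same-sign decomposition (a, c) from its swap (c, a).
  shapeOf : ∀ {s t} → Decomposition s t → Shape
  shapeOf d = shape (sign (a∈A d)) (sign (c∈A d)) (residue (a₁ d) <ᵇ residue (c₁ d))

  signed-sum : ∀ {s t} (d : Decomposition s t) →
    sign (a∈A d) · (a₁ d * a₁ d) + sign (c∈A d) · (c₁ d * c₁ d) ≈ t
  signed-sum d = ≈-trans (≈-sym (+-cong (on-parabola (a∈A d)) (on-parabola (c∈A d)))) (sum₂ d)

  same-shape⇒≈ : ∀ {s t} → ¬ (P ∣ s × P ∣ t) → (d e : Decomposition s t) → shapeOf d ≡ shapeOf e →
    a₁ d ≈ a₁ e × a₂ d ≈ a₂ e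
  same-shape⇒≈ s,t≉0 d e eq = a≈a′ , a₂≈a₂′
    where
    open ≈-Reasoning
    agree = shape-injective eq
    σ≡σ′ = proj₁ agree
    a≈a′ : a₁ d ≈ a₁ e
    a≈a′ = first-summand-unique s,t≉0 σ≡σ′ (proj₁ (proj₂ agree)) (proj₂ (proj₂ agree))
      (sum₁ d) (signed-sum d) (sum₁ e) (signed-sum e)
    a₂≈a₂′ : a₂ d ≈ a₂ e
    a₂≈a₂′ = begin
      a₂ d                              ≈⟨ on-parabola (a∈A d) ⟩
      sign (a∈A d) · (a₁ d * a₁ d)      ≈⟨ ·-cong (sign (a∈A d)) (*-cong a≈a′ a≈a′) ⟩
      sign (a∈A d) · (a₁ e * a₁ e)      ≡⟨ cong (_· (a₁ e * a₁ e)) σ≡σ′ ⟩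
      sign (a∈A e) · (a₁ e * a₁ e)      ≈⟨ on-parabola (a∈A e) ⟨
      a₂ e                              ∎

module CayleyGraph {p : ℕ} (p-prime : Prime p) (p%12≡11 : p % 12 ≡ 11) where

  import Data.Nat as ℕ
  import Data.Nat.Properties as ℕ
  open import Data.Nat.DivMod using (_mod_)
  open import Data.Integer hiding (_%_; ∣_∣; suc; pred; sign; NonZero)
  open import Data.Integer.Properties
  open import Data.Integer.Divisibility.Signed
  open import Data.Integer.Tactic.RingSolver using (solve-∀)
  open import Data.Fin as Fin using (Fin; toℕ; fromℕ<)
  open import Data.Fin.Properties as Fin using (toℕ-fromℕ<; toℕ-injective; toℕ<n; pigeonhole)
  open import Data.Bool using (T)
  open import Data.Product using (∃₂; _,_; proj₁; proj₂)
  open import Data.Empty using (⊥)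
  open import Function using (_∘_)
  open import Data.Sum using (_⊎_; inj₁; inj₂)
  open import Relation.Nullary using (¬_; Dec; yes; no)
  open import Relation.Nullary.Decidable using (⌊_⌋; toWitness; fromWitness; T?)
  open import Relation.Binary.PropositionalEquality hiding ([_])

  open Congruence p-prime
  open Parabolas p-prime p%12≡11
  open Shapes using (shape-index; shape-index-injective)

  ⟦_⟧ : Fin p → ℤ
  ⟦ a ⟧ = + toℕ a

  ⟦⟧-injective : ∀ {a b} → ⟦ a ⟧ ≈ ⟦ b ⟧ → a ≡ b
  ⟦⟧-injective {a} {b} a≈b = toℕ-injective (residue-unique (toℕ<n a) (toℕ<n b) a≈b)

  ⟦mod⟧ : ∀ n → ⟦ n mod p ⟧ ≈ + n
  ⟦mod⟧ n = ≈-trans (≈-reflexive (cong +_ (toℕ-fromℕ< _))) (≈-sym (≈-residue (+ n)))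

  ⟦0⟧ : ⟦ 0𝔽 p ⟧ ≈ 0ℤ
  ⟦0⟧ = ⟦mod⟧ 0

  ⟦sub⟧ : ∀ a b → ⟦ sub𝔽 p a b ⟧ ≈ ⟦ a ⟧ - ⟦ b ⟧
  ⟦sub⟧ a b = begin
    ⟦ sub𝔽 p a b ⟧                      ≈⟨ ⟦mod⟧ (toℕ a ℕ.+ (p ℕ.∸ toℕ b)) ⟩
    + (toℕ a ℕ.+ (p ℕ.∸ toℕ b))         ≡⟨ pos-+ (toℕ a) (p ℕ.∸ toℕ b) ⟩
    ⟦ a ⟧ + + (p ℕ.∸ toℕ b)             ≡⟨ cong (_+_ ⟦ a ⟧) (trans (m-n≡m⊖n p (toℕ b)) (⊖-≥ (ℕ.<⇒≤ (toℕ<n b)))) ⟨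
    ⟦ a ⟧ + (P - ⟦ b ⟧)                  ≈⟨ +-cong (≈-refl {⟦ a ⟧}) (-‿cong₂ (p∣⇒≈0 ∣-refl) (≈-refl {⟦ b ⟧})) ⟩
    ⟦ a ⟧ + (0ℤ - ⟦ b ⟧)                 ≡⟨ cong (_+_ ⟦ a ⟧) (+-identityˡ (- ⟦ b ⟧)) ⟩
    ⟦ a ⟧ - ⟦ b ⟧                        ∎
    where open ≈-Reasoning

  fromℤ : ℤ → Fin p
  fromℤ x = fromℕ< (residue<p x)

  ⟦fromℤ⟧ : ∀ x → ⟦ fromℤ x ⟧ ≈ x
  ⟦fromℤ⟧ x = ≈-trans (≈-reflexive (cong +_ (toℕ-fromℕ< (residue<p x)))) (≈-sym (≈-residue x))

  ⟦_⟧₁ ⟦_⟧₂ : V p → ℤ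
  ⟦ u ⟧₁ = ⟦ proj₁ u ⟧
  ⟦ u ⟧₂ = ⟦ proj₂ u ⟧

  vertex : ℤ → ℤ → V p
  vertex x y = fromℤ x , fromℤ y

  vertex-≡ : ∀ {u v} → ⟦ u ⟧₁ ≈ ⟦ v ⟧₁ → ⟦ u ⟧₂ ≈ ⟦ v ⟧₂ → u ≡ v
  vertex-≡ u₁≈v₁ u₂≈v₂ = cong₂ _,_ (⟦⟧-injective u₁≈v₁) (⟦⟧-injective u₂≈v₂)

  ≢⇒difference≉0 : ∀ {u v} → u ≢ v → ¬ (P ∣ ⟦ u ⟧₁ - ⟦ v ⟧₁ × P ∣ ⟦ u ⟧₂ - ⟦ v ⟧₂)
  ≢⇒difference≉0 u≢v (p∣s , p∣t) = u≢v (vertex-≡ (mk≈ p∣s) (mk≈ p∣t))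

  A : V p → Bool
  A (x , y) = ⌊ InA? ⟦ x ⟧ ⟦ y ⟧ ⌋

  infix 4 _~_
  _~_ : V p → V p → Set
  _~_ = CayAdj p A

  ~⇒InA : ∀ {u v} → u ~ v → InA (⟦ u ⟧₁ - ⟦ v ⟧₁) (⟦ u ⟧₂ - ⟦ v ⟧₂)
  ~⇒InA {u} {v} u~v = InA-resp (⟦sub⟧ (proj₁ u) (proj₁ v)) (⟦sub⟧ (proj₂ u) (proj₂ v)) (toWitness u~v)

  InA⇒~ : ∀ {u v} → InA (⟦ u ⟧₁ - ⟦ v ⟧₁) (⟦ u ⟧₂ - ⟦ v ⟧₂) → u ~ v
  InA⇒~ {u} {v} u-v∈A =
    fromWitness (InA-resp (≈-sym (⟦sub⟧ (proj₁ u) (proj₁ v))) (≈-sym (⟦sub⟧ (proj₂ u) (proj₂ v))) u-v∈A)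

  vertical-≁ : ∀ {u v} → proj₁ u ≡ proj₁ v → ¬ u ~ v
  vertical-≁ {u} {v} u₁≡v₁ u~v = nonzero (~⇒InA {u} {v} u~v)
    (subst (λ b → P ∣ ⟦ u ⟧₁ - ⟦ b ⟧) u₁≡v₁ (subst (P ∣_) (sym (+-inverseʳ ⟦ u ⟧₁)) p∣0))

  A-symmetric : Symmetric p A
  A-symmetric = 0∉A , A-closed-under-neg
    where
    0∉A : ¬ T (A (0V p))
    0∉A 0∈A = nonzero (toWitness 0∈A) (≈0⇒p∣ ⟦0⟧)
    ⟦neg⟧ : ∀ a → ⟦ sub𝔽 p (0𝔽 p) a ⟧ ≈ - ⟦ a ⟧
    ⟦neg⟧ a = ≈-trans (⟦sub⟧ (0𝔽 p) a)
      (≈-trans (-‿cong₂ ⟦0⟧ (≈-refl {⟦ a ⟧})) (≈-reflexive (+-identityˡ (- ⟦ a ⟧))))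
    A-closed-under-neg : ∀ x → T (A x) → T (A (negV p x))
    A-closed-under-neg (x , y) x∈A =
      fromWitness (InA-resp (≈-sym (⟦neg⟧ x)) (≈-sym (⟦neg⟧ y)) (InA-neg (toWitness x∈A)))

  above : V p → V p
  above u = proj₁ u , fromℤ (⟦ u ⟧₂ + 1ℤ)

  above-≢ : ∀ u → above u ≢ u
  above-≢ u above≡u = p∤1
    (subst (P ∣_) (x+1-x≡1 ⟦ u ⟧₂)
      (p∣x-y (≈-trans (≈-sym (⟦fromℤ⟧ (⟦ u ⟧₂ + 1ℤ))) (≈-reflexive (cong ⟦_⟧₂ above≡u)))))
    where
    x+1-x≡1 : ∀ x → x + 1ℤ - x ≡ 1ℤ
    x+1-x≡1 = solve-∀

  ≁-above : ∀ u → ¬ u ~ above u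
  ≁-above u = vertical-≁ {u} {above u} refl

  not-star : ¬ IsStar _~_
  not-star (c , c~all , _) = ≁-above c (c~all (above c) (above-≢ c))

  triangle-free : TriangleFree _~_
  triangle-free u v w u~v v~w w~u = sum-free (~⇒InA {u} {v} u~v) (~⇒InA {v} {w} v~w)
    (InA-resp (≈-reflexive (telescope ⟦ u ⟧₁ ⟦ v ⟧₁ ⟦ w ⟧₁)) (≈-reflexive (telescope ⟦ u ⟧₂ ⟦ v ⟧₂ ⟦ w ⟧₂))
      (InA-neg (~⇒InA {w} {u} w~u)))
    where
    telescope : ∀ x y z → - (z - x) ≡ (x - y) + (y - z)
    telescope = solve-∀

  decomposition⇒path : ∀ {u v} → Decomposition (⟦ u ⟧₁ - ⟦ v ⟧₁) (⟦ u ⟧₂ - ⟦ v ⟧₂) →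
    Σ (V p) λ w → u ~ w × w ~ v
  decomposition⇒path {u} {v} (decomposition {a₁} {a₂} {c₁} {c₂} a∈A c∈A sum₁ sum₂) =
    w , InA⇒~ {u} {w} (InA-resp (first-leg ⟦ u ⟧₁ a₁) (first-leg ⟦ u ⟧₂ a₂) a∈A)
      , InA⇒~ {w} {v} (InA-resp (second-leg ⟦ u ⟧₁ ⟦ v ⟧₁ {a₁} sum₁) (second-leg ⟦ u ⟧₂ ⟦ v ⟧₂ {a₂} sum₂) c∈A)
    where
    w = vertex (⟦ u ⟧₁ - a₁) (⟦ u ⟧₂ - a₂)
    first-leg : ∀ x a → a ≈ x - ⟦ fromℤ (x - a) ⟧
    first-leg x a = begin
      a                        ≡⟨ x-[x-a]≡a x a ⟨
      x - (x - a)              ≈⟨ -‿cong₂ (≈-refl {x}) (⟦fromℤ⟧ (x - a)) ⟨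
      x - ⟦ fromℤ (x - a) ⟧    ∎
      where
      open ≈-Reasoning
      x-[x-a]≡a : ∀ x a → x - (x - a) ≡ a
      x-[x-a]≡a = solve-∀
    second-leg : ∀ x y {a c} → a + c ≈ x - y → c ≈ ⟦ fromℤ (x - a) ⟧ - y
    second-leg x y {a} {c} a+c≈x-y = begin
      c                        ≡⟨ a+c-a≡c a c ⟨
      (a + c) - a              ≈⟨ -‿cong₂ a+c≈x-y (≈-refl {a}) ⟩
      (x - y) - a              ≡⟨ swap x y a ⟩
      (x - a) - y              ≈⟨ -‿cong₂ (⟦fromℤ⟧ (x - a)) (≈-refl {y}) ⟨
      ⟦ fromℤ (x - a) ⟧ - y    ∎
      where
      open ≈-Reasoning
      a+c-a≡c : ∀ a c → (a + c) - a ≡ c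
      a+c-a≡c = solve-∀
      swap : ∀ x y a → (x - y) - a ≡ (x - a) - y
      swap = solve-∀

  diameter-two : HasDiameter2 _~_
  diameter-two = adjacent-or-path , 0V p , above (0V p) , (λ eq → above-≢ (0V p) (sym eq)) , ≁-above (0V p)
    where
    adjacent-or-path : ∀ u v → u ≢ v → u ~ v ⊎ Σ (V p) λ w → u ~ w × w ~ v
    adjacent-or-path u v u≢v = by-cases (T? (A (_−V_ p u v)))
      where
      by-cases : Dec (u ~ v) → u ~ v ⊎ Σ (V p) λ w → u ~ w × w ~ v
      by-cases (yes u~v) = inj₁ u~v
      by-cases (no u≁v)  = inj₂ (decomposition⇒path {u} {v}
        (decompose (≢⇒difference≉0 u≢v) (λ s,t∈A → u≁v (InA⇒~ {u} {v} s,t∈A))))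

  common-neighbour⇒decomposition : ∀ {u v w} → u ~ w → v ~ w →
    Decomposition (⟦ u ⟧₁ - ⟦ v ⟧₁) (⟦ u ⟧₂ - ⟦ v ⟧₂)
  common-neighbour⇒decomposition {u} {v} {w} u~w v~w = decomposition (~⇒InA {u} {w} u~w)
    (InA-resp (≈-reflexive (flip ⟦ v ⟧₁ ⟦ w ⟧₁)) (≈-reflexive (flip ⟦ v ⟧₂ ⟦ w ⟧₂)) (InA-neg (~⇒InA {v} {w} v~w)))
    (≈-reflexive (telescope ⟦ u ⟧₁ ⟦ w ⟧₁ ⟦ v ⟧₁)) (≈-reflexive (telescope ⟦ u ⟧₂ ⟦ w ⟧₂ ⟦ v ⟧₂))
    where
    flip : ∀ x y → - (x - y) ≡ y - x
    flip = solve-∀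
    telescope : ∀ x y z → (x - y) + (y - z) ≡ x - z
    telescope = solve-∀

  -- Common neighbours of u ≠ v with the same shape coincide, and there are only six shapes.
  no-K₂,₇ : ¬ ContainsK2 _~_ 7
  no-K₂,₇ (u , v , f , u≢v , f-injective , f-common) =
    collision (pigeonhole (ℕ.n<1+n 6) (shape-index ∘ shapeOf ∘ d))
    where
    d : ∀ i → Decomposition (⟦ u ⟧₁ - ⟦ v ⟧₁) (⟦ u ⟧₂ - ⟦ v ⟧₂)
    d i = common-neighbour⇒decomposition {u} {v} {f i}
      (proj₁ (proj₂ (proj₂ (f-common i)))) (proj₂ (proj₂ (proj₂ (f-common i))))
    collision : (∃₂ λ i j → i Fin.< j × shape-index (shapeOf (d i)) ≡ shape-index (shapeOf (d j))) → ⊥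
    collision (i , j , i<j , same-index) =
      Fin.<⇒≢ i<j (f-injective
        (vertex-≡ (-‿cancelˡ {⟦ u ⟧₁} (proj₁ u-fᵢ≈u-fⱼ)) (-‿cancelˡ {⟦ u ⟧₂} (proj₂ u-fᵢ≈u-fⱼ))))
      where
      u-fᵢ≈u-fⱼ = same-shape⇒≈ (≢⇒difference≉0 u≢v) (d i) (d j) (shape-index-injective same-index)

theorem1p4 : (p : ℕ) .{{_ : NonZero p}} → Prime p → p % 12 ≡ 11 →
    Σ (V p → Bool) (λ A → Symmetric p A × InW (CayAdj p A) 7)
theorem1p4 p p-prime p%12≡11 = A , A-symmetric , not-star , diameter-two , triangle-free , no-K₂,₇
  where open CayleyGraph p-prime p%12≡11
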